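{- Let $\ell,s,w$ be arbitrary positive integers and let $n=\ell s w+1$. Then every ordered matching on $2n$ vertices contains a line of size $\ell+1$, or a stack of size $s+1$, or a wave of size $w+1$.
   Context: An ordered matching of size $n$ is a graph on a linearly ordered vertex set $V$ with $|V|=2n$ (say $V=\{1,\dots,2n\}$) consisting of $n$ pairwise vertex-disjoint edges (so there are no isolated vertices). The size of a matching is its number of edges. A sub-matching is a subset of the edges, its vertices inheriting the linear order. A matching with $k$ edges $\{a_i,b_i\}$, $a_i<b_i$, $i=1,\dots,k$, numbered so that $a_1<\cdots<a_k$, is called: a line if $a_1<b_1<a_2<b_2<\cdots<a_k<b_k$; a stack if $a_1<a_2<\cdots<a_k<b_k<b_{k-1}<\cdots<b_1$; a wave if $a_1<a_2<\cdots<a_k<b_1<b_2<\cdots<b_k$. A matching contains a line (stack, wave) if some sub-matching of it is a line (stack, wave). -}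

module Defs where

open import Data.Nat.Base using (ℕ; _*_)
open import Data.Fin.Base using (Fin; _<_)
open import Data.List.Base using (List; []; _∷_; _++_; concatMap; length; map; reverse)
open import Data.List.Relation.Binary.Permutation.Propositional using (_↭_)
open import Data.List.Relation.Binary.Subset.Propositional using (_⊆_)
open import Data.List.Relation.Unary.AllPairs using (AllPairs)
open import Data.List.Relation.Unary.Linked using (Linked)
open import Data.Product.Base using (∃-syntax; _×_)
open import Relation.Binary.PropositionalEquality.Core using (_≡_; _≢_)

-- An unordered pair {a , b} of distinct vertices is stored with its smaller
-- endpoint first.
record Edge (m : ℕ) : Set where
  constructor edge
  field
    left right : Fin m
    left<right : left < right

open Edge public

Disjoint : ∀ {m} → Edge m → Edge m → Set
Disjoint e f =
  left e ≢ left f × left e ≢ right f × right e ≢ left f × right e ≢ right f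

-- The edge set is listed in an arbitrary order; pairwise disjointness excludes
-- repetitions, so the length of the list is the number of edges.  Vertices of
-- Fin m may be uncovered here: a sub-matching keeps the ambient type Fin m, and
-- thereby the inherited order, while its own vertices are the covered ones.
record Matching (m : ℕ) : Set where
  constructor matching
  field
    edges    : List (Edge m)
    disjoint : AllPairs Disjoint edges

open Matching public

size : ∀ {m} → Matching m → ℕ
size M = length (edges M)

-- There are no isolated vertices, since n disjoint edges cover all 2n vertices.
record OrderedMatching (n : ℕ) : Set where
  constructor orderedMatching
  field
    graph  : Matching (2 * n)
    size≡n : size graph ≡ n

open OrderedMatching public

_IsSubMatchingOf_ : ∀ {m} → Matching m → Matching m → Set
N IsSubMatchingOf M = edges N ⊆ edges M

-- In the next three definitions es = e₁, …, eₖ is a numbering of the edges, with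
-- eᵢ = {aᵢ , bᵢ} and aᵢ < bᵢ.  Each chain forces a₁ < ⋯ < aₖ.

-- a₁ < b₁ < a₂ < b₂ < ⋯ < aₖ < bₖ
IsLine : ∀ {m} → Matching m → Set
IsLine M = ∃[ es ] es ↭ edges M ×
  Linked _<_ (concatMap (λ e → left e ∷ right e ∷ []) es)

-- a₁ < a₂ < ⋯ < aₖ < bₖ < bₖ₋₁ < ⋯ < b₁
IsStack : ∀ {m} → Matching m → Set
IsStack M = ∃[ es ] es ↭ edges M ×
  Linked _<_ (map left es ++ reverse (map right es))

-- a₁ < a₂ < ⋯ < aₖ < b₁ < b₂ < ⋯ < bₖ
IsWave : ∀ {m} → Matching m → Set
IsWave M = ∃[ es ] es ↭ edges M ×
  Linked _<_ (map left es ++ map right es)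

ContainsOfSize : ∀ {m} → (Matching m → Set) → ℕ → Matching m → Set
ContainsOfSize P k M = ∃[ N ] N IsSubMatchingOf M × size N ≡ k × P N

{-# OPTIONS --safe #-}

-- "Lies entirely to the left of" and "encloses" are decidable relations on edges.
-- Peeling off minimal elements (Mirsky) gives, among ℓ s w + 1 edges, a chain of
-- ℓ + 1 edges for the first, which is a line, or s w + 1 pairwise intersecting
-- edges.  Among the latter there is a chain of s + 1 edges for the second, which
-- is a stack, or w + 1 edges none of which encloses another, which form a wave
-- when sorted by left endpoint: crossing is not transitive in general, but here
-- all left endpoints precede all right endpoints.
module Submission where

open import Defs
open import Data.Nat.Base using (ℕ; zero; suc; _+_; _*_; _≤_; _<_; s≤s; NonZero)
open import Data.Nat.Properties using
  (≤-refl; ≤-reflexive; ≤-trans; <-≤-trans; +-monoˡ-≤; +-suc; +-comm; *-assoc;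
   +-cancelˡ-<; _<?_; ≮⇒≥; m≤n⇒m⊓n≡m)
import Data.Fin.Base as Fin
import Data.Fin.Properties as Fin
open import Data.List.Base using
  (List; []; _∷_; _++_; concatMap; filter; length; map; reverse; take)
open import Data.List.Properties using (length-take; unfold-reverse)
open import Data.List.Membership.Propositional using (_∈_; find; lose)
open import Data.List.Membership.Propositional.Properties using (∈-filter⁻; ∈-AllPairs₂)
open import Data.List.Relation.Binary.Permutation.Propositional using (_↭_; ↭-refl; ↭-sym; ↭⇒↭ₛ)
open import Data.List.Relation.Binary.Permutation.Propositional.Properties using (∈-resp-↭; ↭-reverse)
import Data.List.Relation.Binary.Permutation.Setoid.Properties as ↭ₛ
open import Data.List.Relation.Binary.Sublist.Propositional using ([]; _∷_; _∷ʳ_; ⊆-trans)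
  renaming (_⊆_ to _⊑_; lookup to ⊑⇒⊆)
open import Data.List.Relation.Binary.Sublist.Propositional.Properties using
  (All-resp-⊆; filter-⊆; take-⊆)
open import Data.List.Relation.Binary.Subset.Propositional using (_⊆_)
import Data.List.Relation.Unary.All as All
open import Data.List.Relation.Unary.All using (All; []; _∷_)
import Data.List.Relation.Unary.All.Properties as All
open import Data.List.Relation.Unary.Any using (Any; here; there; any?)
import Data.List.Relation.Unary.AllPairs as AllPairs
open import Data.List.Relation.Unary.AllPairs using (AllPairs; []; _∷_)
import Data.List.Relation.Unary.AllPairs.Properties as AllPairs
open import Data.List.Relation.Unary.Linked using (Linked; []; [-]; _∷_)
open import Data.List.Relation.Unary.Linked.Properties using (AllPairs⇒Linked; Linked⇒AllPairs)
import Data.List.Sort as Sort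
open import Data.Product.Base using (∃-syntax; _×_; _,_; proj₁; proj₂)
open import Data.Sum.Base using (_⊎_; inj₁; inj₂)
open import Function.Base using (_∘_)
open import Level using (Level)
open import Relation.Binary.Bundles using (DecTotalOrder)
open import Relation.Binary.Core using (Rel)
import Relation.Binary.Construct.On as On
open import Relation.Binary.Definitions using (Decidable; Symmetric; Transitive)
open import Relation.Binary.PropositionalEquality using
  (_≡_; _≢_; refl; sym; trans; cong; subst; resp₂; setoid)
open import Relation.Nullary using (¬_; yes; no; ¬?)
open import Relation.Nullary.Decidable using (_×-dec_)
import Relation.Unary as U

private
  variable
    a p r : Level
    A : Set a

-- Pairwise relations and counting in lists.

AllPairs-resp-⊑ : {R : Rel A r} {xs ys : List A} → ys ⊑ xs → AllPairs R xs → AllPairs R ys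
AllPairs-resp-⊑ []         _          = []
AllPairs-resp-⊑ (_ ∷ʳ τ)   (_ ∷ ps)   = AllPairs-resp-⊑ τ ps
AllPairs-resp-⊑ (refl ∷ τ) (px ∷ ps)  = All-resp-⊆ τ px ∷ AllPairs-resp-⊑ τ ps

AllPairs-resp-↭ : {R : Rel A r} → Symmetric R → {xs ys : List A} →
  xs ↭ ys → AllPairs R xs → AllPairs R ys
AllPairs-resp-↭ {R = R} R-sym τ = ↭ₛ.AllPairs-resp-↭ (setoid _) R-sym (resp₂ R) (↭⇒↭ₛ τ)

AllPairs-universal : {R : Rel A r} {xs : List A} →
  (∀ {x y} → x ∈ xs → y ∈ xs → R x y) → AllPairs R xs
AllPairs-universal {xs = []}     _ = []
AllPairs-universal {xs = x ∷ xs} f =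
  All.tabulate (f (here refl) ∘ there) ∷ AllPairs-universal (λ x∈ y∈ → f (there x∈) (there y∈))

AllPairs-reverse : {R : Rel A r} {xs : List A} →
  AllPairs (λ x y → R y x) xs → AllPairs R (reverse xs)
AllPairs-reverse []                               = []
AllPairs-reverse {R = R} {xs = x ∷ xs} (px ∷ pxs) =
  subst (AllPairs R) (sym (unfold-reverse x xs))
    (AllPairs.++⁺ (AllPairs-reverse pxs) ([] ∷ [])
      (All.tabulate (λ y∈ → All.lookup px (∈-resp-↭ (↭-reverse xs) y∈) ∷ [])))

module _ {P : U.Pred A p} (P? : U.Decidable P) where

  length≤filter-¬+filter : ∀ xs →
    length xs ≤ length (filter (¬? ∘ P?) xs) + length (filter P? xs)
  length≤filter-¬+filter []       = ≤-refl
  length≤filter-¬+filter (x ∷ xs) with P? x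
  ... | yes _ = subst (suc (length xs) ≤_) (sym (+-suc _ _)) (s≤s (length≤filter-¬+filter xs))
  ... | no  _ = s≤s (length≤filter-¬+filter xs)

-- Mirsky's theorem.

module _ {R : Rel A r} (R? : Decidable R) where

  -- The order of `ys` is dictated by `R` and not by `xs`, hence `⊆`, which by itself does not bar
  -- repetitions.
  ChainIn : ℕ → List A → Set _
  ChainIn k xs = ∃[ ys ] ys ⊆ xs × length ys ≡ k × Linked R ys

  -- A sublist, so that pairwise properties of `xs`, such as disjointness of edges, pass to `ys`.
  AntichainIn : ℕ → List A → Set _
  AntichainIn k xs = ∃[ ys ] ys ⊑ xs × length ys ≡ k × (∀ {x y} → x ∈ ys → y ∈ ys → ¬ R x y)

  hasPredecessor? : ∀ xs → U.Decidable (λ x → Any (λ y → R y x) xs)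
  hasPredecessor? xs x = any? (λ y → R? y x) xs

  -- Induction on `k`. Elements without a predecessor in `xs` form an antichain; if there are at
  -- most `n` of them, they are discarded and a chain among the rest is extended downwards.
  mirsky : ∀ k n xs → k * n < length xs → ChainIn (suc k) xs ⊎ AntichainIn (suc n) xs
  mirsky zero n (x ∷ xs) _ = inj₁ (x ∷ [] , (λ { (here refl) → here refl }) , refl , [-])
  mirsky (suc k) n xs big with n <? length (filter (¬? ∘ hasPredecessor? xs) xs)
  ... | yes n<#min = inj₂
    ( take (suc n) minimals
    , ⊆-trans (take-⊆ (suc n) minimals) (filter-⊆ minimal? xs)
    , trans (length-take (suc n) minimals) (m≤n⇒m⊓n≡m n<#min)
    -- Here `x` would be a predecessor of the minimal element `y`.
    , λ x∈ y∈ xRy → proj₂ (∈-filter⁻ minimal? {xs = xs} (⊑⇒⊆ (take-⊆ (suc n) minimals) y∈))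
        (lose (proj₁ (∈-filter⁻ minimal? {xs = xs} (⊑⇒⊆ (take-⊆ (suc n) minimals) x∈))) xRy) )
    where
    minimal? = ¬? ∘ hasPredecessor? xs
    minimals = filter minimal? xs
  -- From `n + k * n < length xs`, discarding at most `n` elements leaves more than `k * n`.
  ... | no n≮#min with mirsky k n (filter (hasPredecessor? xs) xs)
                        (+-cancelˡ-< n _ _ (<-≤-trans big (≤-trans
                          (length≤filter-¬+filter (hasPredecessor? xs) xs)
                          (+-monoˡ-≤ _ (≮⇒≥ n≮#min)))))
  ...   | inj₂ (ys , ys⊑ , len , anti) = inj₂ (ys , ⊆-trans ys⊑ (filter-⊆ _ xs) , len , anti)
  ...   | inj₁ (c ∷ cs , c∷cs⊆ , len , chain)
          -- The bottom `c` passed the filter, so it has a predecessor `y` in the unfiltered list;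
          -- `y` itself may be a discarded element.
          with find (proj₂ (∈-filter⁻ (hasPredecessor? xs) {xs = xs} (c∷cs⊆ (here refl))))
  ...     | y , y∈xs , yRc = inj₁
    ( y ∷ c ∷ cs
    , (λ { (here refl) → y∈xs ; (there z∈) → ⊑⇒⊆ (filter-⊆ _ xs) (c∷cs⊆ z∈) })
    , cong suc len
    , yRc ∷ chain )

-- Relative positions of two edges.

module _ {m : ℕ} where

  _leftOf_ : Rel (Edge m) _
  e leftOf f = right e Fin.< left f

  _encloses_ : Rel (Edge m) _
  e encloses f = left e Fin.< left f × right f Fin.< right e

  leftOf? : Decidable _leftOf_
  leftOf? e f = right e Fin.<? left f

  encloses? : Decidable _encloses_
  encloses? e f = left e Fin.<? left f ×-dec right f Fin.<? right e

  leftOf-trans : Transitive _leftOf_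
  leftOf-trans {e} {f} {g} e<f f<g =
    Fin.<-trans {i = right e} e<f (Fin.<-trans {i = left f} (left<right f) f<g)

  encloses-trans : Transitive _encloses_
  encloses-trans {e} {f} {g} (l₁ , r₁) (l₂ , r₂) =
    Fin.<-trans {i = left e} l₁ l₂ , Fin.<-trans {i = right g} r₂ r₁

  Disjoint-sym : Symmetric (Disjoint {m})
  Disjoint-sym (ll , lr , rl , rr) = ll ∘ sym , rl ∘ sym , lr ∘ sym , rr ∘ sym

  -- Makes a chain into a matching: being only a subset of the edges, it does not inherit
  -- disjointness.
  leftOf⇒Disjoint : ∀ {e f} → e leftOf f → Disjoint e f
  leftOf⇒Disjoint {e} {f} e<f =
    Fin.<⇒≢ le<lf ,
    Fin.<⇒≢ (Fin.<-trans {i = left e} le<lf (left<right f)) ,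
    Fin.<⇒≢ e<f ,
    Fin.<⇒≢ (Fin.<-trans {i = right e} e<f (left<right f))
    where
    le<lf = Fin.<-trans {i = left e} (left<right e) e<f

  left≢right : ∀ {xs : List (Edge m)} → AllPairs Disjoint xs → ∀ {e f} → e ∈ xs → f ∈ xs → left e ≢ right f
  left≢right disj {e} e∈ f∈ with ∈-AllPairs₂ disj e∈ f∈
  ... | inj₁ refl                       = Fin.<⇒≢ (left<right e)
  ... | inj₂ (inj₁ (_ , lr , _ , _)) = lr
  ... | inj₂ (inj₂ (_ , _ , rl , _)) = rl ∘ sym

  -- Applied to a pair in both orders, this says that the two intervals overlap. It supplies the
  -- inequality between the last left endpoint and the first right endpoint in stacks and waves.
  Intersecting : List (Edge m) → Set
  Intersecting xs = ∀ {e f} → e ∈ xs → f ∈ xs → left e Fin.< right f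

  -- As `f` is not left of `e`, `left e` is at most `right f`; equality would need a vertex shared
  -- by two edges or a degenerate edge.
  ¬leftOf⇒Intersecting : ∀ {xs} → AllPairs Disjoint xs →
    (∀ {e f} → e ∈ xs → f ∈ xs → ¬ e leftOf f) → Intersecting xs
  ¬leftOf⇒Intersecting disj anti e∈ f∈ =
    Fin.≤∧≢⇒< (≮⇒≥ (anti f∈ e∈)) (left≢right disj e∈ f∈)

  leftOf-chain⇒line : ∀ {es} → Linked _leftOf_ es →
    Linked Fin._<_ (concatMap (λ e → left e ∷ right e ∷ []) es)
  leftOf-chain⇒line []                 = []
  leftOf-chain⇒line {e ∷ []} [-]       = left<right e ∷ [-]
  leftOf-chain⇒line {e ∷ _ ∷ _} (p ∷ ps) = left<right e ∷ p ∷ leftOf-chain⇒line ps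

  encloses-chain⇒stack : ∀ {es} → Intersecting es → AllPairs _encloses_ es →
    Linked Fin._<_ (map left es ++ reverse (map right es))
  encloses-chain⇒stack {es} inter nested = AllPairs⇒Linked (AllPairs.++⁺
    (AllPairs.map⁺ (AllPairs.map proj₁ nested))
    (AllPairs-reverse (AllPairs.map⁺ (AllPairs.map proj₂ nested)))
    (All.map⁺ (All.tabulate λ e∈ → All.anti-mono (∈-resp-↭ (↭-reverse (map right es)))
      (All.map⁺ (All.tabulate (inter e∈))))))

  -- Nesting separates endpoints of the same kind, and `Intersecting`, used in both orders,
  -- separates a left from a right endpoint.
  encloses-chain⇒Disjoint : ∀ {es} → Intersecting es → AllPairs _encloses_ es → AllPairs Disjoint es
  encloses-chain⇒Disjoint inter nested = AllPairs.zipWith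
    (λ { ((ll , rr) , lr , rl) → Fin.<⇒≢ ll , Fin.<⇒≢ lr , Fin.<⇒≢ rl ∘ sym , Fin.<⇒≢ rr ∘ sym })
    (nested , AllPairs-universal λ e∈ f∈ → inter e∈ f∈ , inter f∈ e∈)

  private
    module ByLeft = DecTotalOrder (On.decTotalOrder (Fin.≤-decTotalOrder m) (left {m}))
    open Sort (On.decTotalOrder (Fin.≤-decTotalOrder m) (left {m})) using (sort; sort-↭; sort-↗)

  -- Disjointness makes the sorted left endpoints strictly increasing. A later edge with a smaller
  -- right endpoint would then be enclosed, so the right endpoints increase too.
  sort-wave : ∀ {xs} → AllPairs Disjoint xs → Intersecting xs →
    (∀ {e f} → e ∈ xs → f ∈ xs → ¬ e encloses f) →
    Linked Fin._<_ (map left (sort xs) ++ map right (sort xs))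
  sort-wave {xs} disj inter anti = AllPairs⇒Linked (AllPairs.++⁺
    (AllPairs.map⁺ (AllPairs.map proj₁ crossing))
    (AllPairs.map⁺ (AllPairs.map proj₂ crossing))
    (All.map⁺ (All.tabulate λ e∈ → All.map⁺ (All.tabulate λ f∈ → inter (from e∈) (from f∈)))))
    where
    from : ∀ {e} → e ∈ sort xs → e ∈ xs
    from = ∈-resp-↭ (sort-↭ xs)

    crossing : AllPairs (λ e f → left e Fin.< left f × right e Fin.< right f) (sort xs)
    crossing = AllPairs.zipWith
      (λ { {e} {f} (le≤lf , (ll , _ , _ , rr) , ¬enc) →
           let le<lf = Fin.≤∧≢⇒< le≤lf ll
           in le<lf , Fin.≤∧≢⇒< (≮⇒≥ λ rf<re → ¬enc (le<lf , rf<re)) rr })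
      ( Linked⇒AllPairs (λ {e} {f} {g} → ByLeft.trans {e} {f} {g}) (sort-↗ xs)
      , AllPairs.zip
          ( AllPairs-resp-↭ (λ {e} {f} → Disjoint-sym {e} {f}) (↭-sym (sort-↭ xs)) disj
          , AllPairs-universal (λ e∈ f∈ → anti (from e∈) (from f∈)) ) )

  -- Two applications of Mirsky's theorem.

  line-stack-or-wave : ∀ ℓ s w (M : Matching m) → ℓ * (s * w) < size M →
    ContainsOfSize IsLine (suc ℓ) M ⊎ ContainsOfSize IsStack (suc s) M ⊎ ContainsOfSize IsWave (suc w) M
  line-stack-or-wave ℓ s w (matching es disj) big with mirsky leftOf? ℓ (s * w) es big
  ... | inj₁ (ls , ls⊆es , len , chain) = inj₁
    ( matching ls (AllPairs.map (λ {e} {f} → leftOf⇒Disjoint {e} {f})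
        (Linked⇒AllPairs (λ {e} {f} {g} → leftOf-trans {e} {f} {g}) chain))
    , ls⊆es , len , ls , ↭-refl , leftOf-chain⇒line chain )
  ... | inj₂ (xs , xs⊑es , xs-len , xs-anti)
      -- The antichain has exactly `suc (s * w)` edges, just above the threshold for the second
      -- application.
      with mirsky encloses? s w xs (≤-reflexive (sym xs-len))
  ...   | inj₁ (ss , ss⊆xs , len , chain) = inj₂ (inj₁
    ( matching ss (encloses-chain⇒Disjoint inter nested)
    , ⊑⇒⊆ xs⊑es ∘ ss⊆xs , len , ss , ↭-refl , encloses-chain⇒stack inter nested ))
    where
    inter : Intersecting ss
    inter e∈ f∈ = ¬leftOf⇒Intersecting (AllPairs-resp-⊑ xs⊑es disj) xs-anti (ss⊆xs e∈) (ss⊆xs f∈)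
    nested = Linked⇒AllPairs (λ {e} {f} {g} → encloses-trans {e} {f} {g}) chain
  ...   | inj₂ (ws , ws⊑xs , len , ws-anti) = inj₂ (inj₂
    ( matching ws ws-disj
    , ⊑⇒⊆ ws⊑es , len , sort ws , sort-↭ ws
    , sort-wave ws-disj
        (¬leftOf⇒Intersecting ws-disj λ e∈ f∈ → xs-anti (⊑⇒⊆ ws⊑xs e∈) (⊑⇒⊆ ws⊑xs f∈))
        ws-anti ))
    where
    ws⊑es = ⊆-trans ws⊑xs xs⊑es
    ws-disj = AllPairs-resp-⊑ ws⊑es disj

theorem1 : (ℓ s w : ℕ) → .{{_ : NonZero ℓ}} → .{{_ : NonZero s}} → .{{_ : NonZero w}} →
    (M : OrderedMatching (ℓ * s * w + 1)) →
    ContainsOfSize IsLine (ℓ + 1) (graph M)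
    ⊎ ContainsOfSize IsStack (s + 1) (graph M)
    ⊎ ContainsOfSize IsWave (w + 1) (graph M)
theorem1 ℓ s w M rewrite +-comm ℓ 1 | +-comm s 1 | +-comm w 1 =
  line-stack-or-wave ℓ s w (graph M) (≤-reflexive (trans
    (cong suc (sym (*-assoc ℓ s w)))
    (trans (+-comm 1 (ℓ * s * w)) (sym (size≡n M)))))
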